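{- The following hold: (i) $F(n,n,\ell)\le 2\ell(n-1)$; (ii) for every $k$ with $2\le k\le n$, $F(n,k,1)=2(n-1)$ and $Ex(n,k,1)$ consists of symmetric digraphs whose underlying undirected graphs are trees.
   Context: Digraphs are finite, without loops and without parallel arcs (a pair of opposite arcs $xy$, $yx$ is allowed). A digraph is strong if it is strongly connected. For a digraph $D=(V,A)$ of order $n=|V|$ and a set $S\subseteq V$ with $|S|=k$, $2\le k\le n$, strong subgraphs $D_1,\dots,D_p$ of $D$ containing $S$ are internally disjoint if $V(D_i)\cap V(D_j)=S$ and $A(D_i)\cap A(D_j)=\emptyset$ for all $1\le i<j\le p$. $\kappa_S(D)$ is the maximum number of internally disjoint strong subgraphs of $D$ containing $S$ (it is $0$ if there are none). The strong subgraph $k$-connectivity is $\kappa_k(D)=\min\{\kappa_S(D)\mid S\subseteq V,\ |S|=k\}$. A digraph $D$ is minimally strong subgraph $(k,\ell)$-connected if $\kappa_k(D)\ge \ell$ but $\kappa_k(D-e)\le \ell-1$ for every arc $e\in A(D)$. $\mathfrak{F}(n,k,\ell)$ is the set of all minimally strong subgraph $(k,\ell)$-connected digraphs of order $n$; when this set is nonempty, $F(n,k,\ell)=\max\{|A(D)|\mid D\in\mathfrak{F}(n,k,\ell)\}$ and $Ex(n,k,\ell)=\{D\mid D\in\mathfrak{F}(n,k,\ell),\ |A(D)|=F(n,k,\ell)\}$. A digraph $D$ is symmetric if for every arc $xy$ of $D$, $yx$ is also an arc of $D$; equivalently, $D$ is obtained from its underlying undirected graph by replacing every edge $xy$ with the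 two arcs $xy$ and $yx$. -}

module Defs where

open import Algebra.Properties.CommutativeMonoid.Sum using (sum)
open import Data.Fin.Base using (Fin; zero; suc; inject₁; fromℕ) renaming (_<_ to _<ᶠ_)
open import Data.Fin.Properties using (_≟_)
open import Data.Fin.Subset using (Subset; _∈_; _∉_; _⊆_; _∩_; _-_; ∣_∣)
open import Data.Fin.Subset.Properties using (p─q⊆p)
open import Data.Nat.Base using (ℕ; suc; _≤_; _<_)
open import Data.Nat.Properties using (+-0-commutativeMonoid)
open import Data.Product.Base using (∃; ∃-syntax; _×_; _,_)
open import Data.Sum.Base using (_⊎_; [_,_]; swap)
open import Data.Vec.Functional using (updateAt)
open import Data.Vec.Functional.Properties using (updateAt-updates; updateAt-minimal)
open import Function.Base using (_∘_)
open import Function.Definitions using (Injective)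
open import Level using (0ℓ)
open import Relation.Binary.Core using (Rel)
open import Relation.Binary.Construct.Closure.ReflexiveTransitive using (Star)
open import Relation.Binary.Definitions using (Symmetric)
open import Relation.Binary.PropositionalEquality using (_≡_; refl; subst)
open import Relation.Nullary.Decidable.Core using (yes; no)
open import Relation.Nullary.Negation.Core using (¬_)

-- A set P of natural numbers has maximum (minimum) m. The invariants κ_S, κ_k
-- and F are represented below by relations "the value is m" built from these,
-- so that nothing has to be assigned to the maximum of an empty set.

IsMaximum : (ℕ → Set) → ℕ → Set
IsMaximum P m = P m × (∀ a → P a → a ≤ m)

IsMinimum : (ℕ → Set) → ℕ → Set
IsMinimum P m = P m × (∀ a → P a → m ≤ a)

-- The arc xy is present when y belongs to the out-neighbourhood N⁺ x.
record Digraph (n : ℕ) : Set where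
  field
    N⁺       : Fin n → Subset n
    loopless : ∀ x → x ∉ N⁺ x

open Digraph public

Arc : ∀ {n} → Digraph n → Rel (Fin n) 0ℓ
Arc D x y = y ∈ N⁺ D x

size : ∀ {n} → Digraph n → ℕ
size D = sum +-0-commutativeMonoid (λ x → ∣ N⁺ D x ∣)

deleteArc : ∀ {n} → Digraph n → Fin n → Fin n → Digraph n
deleteArc D x y .N⁺ = updateAt (N⁺ D) x (_- y)
deleteArc D x y .loopless u u∈ with u ≟ x
... | yes refl = loopless D u
  (p─q⊆p _ _ (subst (u ∈_) (updateAt-updates u (N⁺ D)) u∈))
... | no u≢x = loopless D u
  (subst (u ∈_) (updateAt-minimal u x (N⁺ D) u≢x) u∈)

record Subgraph {n : ℕ} (D : Digraph n) : Set where
  field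
    V      : Subset n
    A⁺     : Fin n → Subset n
    A⁺⊆N⁺  : ∀ x → A⁺ x ⊆ N⁺ D x
    tail∈V : ∀ {x y} → y ∈ A⁺ x → x ∈ V
    head∈V : ∀ {x y} → y ∈ A⁺ x → y ∈ V

open Subgraph public

SubArc : ∀ {n} {D : Digraph n} → Subgraph D → Rel (Fin n) 0ℓ
SubArc H x y = y ∈ A⁺ H x

Strong : ∀ {n} {D : Digraph n} → Subgraph D → Set
Strong H = ∀ {x y} → x ∈ V H → y ∈ V H → Star (SubArc H) x y

record InternallyDisjoint {n} (D : Digraph n) (S : Subset n) (p : ℕ) : Set where
  field
    member            : Fin p → Subgraph D
    strong            : ∀ i → Strong (member i)
    containsS         : ∀ i → S ⊆ V (member i)
    internallyVertex  : ∀ {i j} → i <ᶠ j → V (member i) ∩ V (member j) ≡ S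
    arcDisjoint       : ∀ {i j} → i <ᶠ j →
                        ∀ {x y} → SubArc (member i) x y → ¬ SubArc (member j) x y

-- κ_S(D) = p. The empty family is always available, which gives the value 0
-- when no strong subgraph contains S.
κS≡ : ∀ {n} → Digraph n → Subset n → ℕ → Set
κS≡ D S = IsMaximum (InternallyDisjoint D S)

-- κ_k(D) = m.
κ≡ : ∀ {n} → ℕ → Digraph n → ℕ → Set
κ≡ k D = IsMinimum (λ p → ∃[ S ] ∣ S ∣ ≡ k × κS≡ D S p)

-- The bound κ_k(D - e) ≤ ℓ - 1 is written with < because subtraction on ℕ
-- truncates at ℓ = 0.
MinimallyStrong : ∀ {n} → ℕ → ℕ → Digraph n → Set
MinimallyStrong k ℓ D =
    (∃[ m ] κ≡ k D m × ℓ ≤ m)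
  × (∀ {x y} → Arc D x y → ∃[ m ] κ≡ k (deleteArc D x y) m × m < ℓ)

𝔉 : (n k ℓ : ℕ) → Digraph n → Set
𝔉 n k ℓ D = MinimallyStrong k ℓ D

-- F(n,k,ℓ) = m; in particular 𝔉(n,k,ℓ) is nonempty.
F≡ : (n k ℓ : ℕ) → ℕ → Set
F≡ n k ℓ = IsMaximum (λ a → ∃[ D ] 𝔉 n k ℓ D × size D ≡ a)

Ex : (n k ℓ : ℕ) → Digraph n → Set
Ex n k ℓ D = 𝔉 n k ℓ D × F≡ n k ℓ (size D)

SymmetricDigraph : ∀ {n} → Digraph n → Set
SymmetricDigraph D = Symmetric (Arc D)

record Graph (n : ℕ) : Set₁ where
  field
    Edge        : Rel (Fin n) 0ℓ
    symmetric   : Symmetric Edge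
    irreflexive : ∀ x → ¬ Edge x x

open Graph public

underlying : ∀ {n} → Digraph n → Graph n
underlying D .Edge x y      = Arc D x y ⊎ Arc D y x
underlying D .symmetric     = swap
underlying D .irreflexive x = [ loopless D x , loopless D x ]

Connected : ∀ {n} → Graph n → Set
Connected G = ∀ x y → Star (Edge G) x y

-- A cycle c₀ c₁ … c_r c₀ on r + 1 ≥ 3 distinct vertices.
record Cycle {n} (G : Graph n) : Set where
  field
    r      : ℕ
    2≤r    : 2 ≤ r
    c      : Fin (suc r) → Fin n
    c-inj  : Injective _≡_ _≡_ c
    step   : ∀ (i : Fin r) → Edge G (c (inject₁ i)) (c (suc i))
    close  : Edge G (c (fromℕ r)) (c zero)

IsTree : ∀ {n} → Graph n → Set
IsTree G = Connected G × ¬ Cycle G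

-- A strong digraph on n vertices has a strong spanning subgraph with at most
-- 2(n − 1) arcs: an out-branching and an in-branching with the same root. For (i),
-- ℓ arc-disjoint strong spanning subgraphs are thinned out in this way; an arc
-- outside their union could be deleted without lowering κ_n below ℓ.
-- For (ii), minimally strong subgraph (k,1)-connected means that the digraph is
-- strong and every arc xy is the only way from x to y, whatever k is; all arcs
-- then lie in the two branchings. If there is a directed cycle of length c ≥ 3,
-- both branchings can be rooted at the cycle, which leaves only 2n − c arcs. Hence
-- in an extremal digraph the arc xy closes a path from y to x only if that path is
-- the arc yx, so the digraph is symmetric, and its underlying graph is acyclic.
module Submission where

open import Defs
open import Data.Nat.Base using (ℕ; _≤_; _*_; _∸_)
open import Data.Product.Base using (_×_)
open import Function.Bundles using (_⇔_)

open import Data.Fin.Base using (Fin; zero; suc; inject₁; fromℕ; inject≤) renaming (_<_ to _<ᶠ_)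
open import Data.Fin.Properties using (_≟_; any?; injective⇒≤; suc-injective; toℕ-inject≤; 0≢1+n)
  renaming (<-cmp to <ᶠ-cmp)
open import Data.Fin.Subset using (Subset; inside; outside; _∈_; _∉_; _⊆_; _∪_; _-_; ⁅_⁆; ⊤; ∣_∣)
open import Data.Fin.Subset.Properties
  using (_∈?_; ∈⊤; ⊆⊤; ∣⊤∣≡n; ∣p∣≡n⇒p≡⊤; ∣⁅x⁆∣≡1; x∈⁅x⁆; x∈⁅y⁆⇒x≡y
        ; p─q⊆p; x∈p∧x∉q⇒x∈p─q; ∪-identityʳ; p⊆p∪q; q⊆p∪q; ∩-idem)
open import Data.List.Base using (List; []; _∷_; _++_; map; concat; tabulate; length; lookup)
open import Data.List.Membership.Propositional using () renaming (_∈_ to _∈ˡ_; _∉_ to _∉ˡ_)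
open import Data.List.Membership.Propositional.Properties
  using (∈-lookup; ∈-map⁺; ∈-map⁻; ∈-++⁺ˡ; ∈-++⁺ʳ; ∈-++⁻; ∈-concat⁺′; ∈-concat⁻′; ∈-tabulate⁺; ∈-tabulate⁻; ∈-allFin)
open import Data.List.Membership.Setoid.Properties using (index-injective)
import Data.List.Membership.DecPropositional as DecMembership
open import Data.List.Properties using (length-map; length-++; length-tabulate)
open import Data.List.Relation.Unary.All as All using ([]; _∷_)
open import Data.List.Relation.Unary.All.Properties using (¬Any⇒All¬) renaming (tabulate⁺ to All-tabulate⁺)
open import Data.List.Relation.Unary.AllPairs using ([]; _∷_)
import Data.List.Relation.Unary.AllPairs.Properties as AllPairs
open import Data.List.Relation.Unary.Any using (here; there; index)
open import Data.List.Relation.Unary.Unique.Propositional using (Unique)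
open import Data.List.Relation.Unary.Unique.Propositional.Properties using (map⁺; concat⁺; allFin⁺)
open import Data.Nat.Base using (zero; suc; _+_; _<_; z≤n; s≤s)
open import Data.Nat.Properties
  using (+-0-commutativeMonoid; ≤-refl; ≤-trans; ≤-antisym; ≤-reflexive; ≤-pred; <-irrefl
        ; +-comm; +-suc; *-comm; *-assoc; *-suc; +-monoʳ-≤
        ; +-cancelʳ-≡; +-cancelʳ-≤; m≤n⇒m<n∨m≡n; m≤n⇒m≤1+n; m≤m+n; ≤∧≢⇒<; module ≤-Reasoning)
open import Data.Nat.Tactic.RingSolver using (solve-∀)
open import Algebra.Properties.CommutativeMonoid.Sum +-0-commutativeMonoid using (sum; sum-cong-≗)
open import Data.Product.Base using (∃; ∃-syntax; _,_; proj₁; proj₂; swap)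
open import Data.Product.Properties using (,-injectiveˡ; ,-injectiveʳ; ≡-dec)
open import Data.Sum.Base using (_⊎_; inj₁; inj₂; [_,_])
open import Data.Vec.Base using ([]; _∷_; here; there)
open import Data.Vec.Functional.Properties using (updateAt-updates; updateAt-minimal)
open import Function.Base using (_∘_; id; flip)
open import Function.Bundles using (mk⇔)
open import Level using (0ℓ)
open import Relation.Binary.Core using (Rel; _⇒_)
open import Relation.Binary.Construct.Closure.ReflexiveTransitive using (Star; ε; _◅_; _◅◅_; _⋆; return; reverse)
  renaming (map to Star-map)
open import Relation.Binary.Definitions using (Decidable; Symmetric; tri<; tri≈; tri>)
open import Relation.Binary.PropositionalEquality
  using (_≡_; _≢_; refl; sym; trans; cong; cong₂; subst; subst₂; setoid; module ≡-Reasoning)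
open import Relation.Nullary.Decidable using (Dec; yes; no; ¬?; _×-dec_; decidable-stable; map′; ¬¬-excluded-middle)
open import Relation.Nullary.Negation.Core using (¬_; contradiction; ¬¬-map)

-- Unique lists

unique⇒lookup-injective : ∀ {A : Set} {xs : List A} → Unique xs →
                          ∀ {i j} → lookup xs i ≡ lookup xs j → i ≡ j
unique⇒lookup-injective (_ ∷ _) {zero} {zero} _ = refl
unique⇒lookup-injective {xs = _ ∷ xs} (x∉ ∷ _) {zero} {suc j} eq =
  contradiction eq (All.lookup x∉ (∈-lookup {xs = xs} j))
unique⇒lookup-injective {xs = _ ∷ xs} (x∉ ∷ _) {suc i} {zero} eq =
  contradiction (sym eq) (All.lookup x∉ (∈-lookup {xs = xs} i))
unique⇒lookup-injective (_ ∷ xs!) {suc i} {suc j} eq =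
  cong suc (unique⇒lookup-injective xs! eq)

-- Sending each position in `xs` to a position of the same entry in `ys` is injective because `xs`
-- has no repetitions. The counts of vertices and arcs below rest on this pigeonhole argument.
unique-⊆⇒length≤ : ∀ {A : Set} {xs ys : List A} → Unique xs →
                   (∀ {a} → a ∈ˡ xs → a ∈ˡ ys) → length xs ≤ length ys
unique-⊆⇒length≤ {A} {xs} xs! xs⊆ys =
  injective⇒≤ {f = λ i → index (xs⊆ys (∈-lookup {xs = xs} i))} λ eq →
    unique⇒lookup-injective xs! (index-injective (setoid A) (xs⊆ys (∈-lookup _)) (xs⊆ys (∈-lookup _)) eq)

unique⇒length≤n : ∀ {n} {vs : List (Fin n)} → Unique vs → length vs ≤ n
unique⇒length≤n {n} {vs} vs! =
  subst (length vs ≤_) (length-tabulate {n = n} id) (unique-⊆⇒length≤ vs! λ _ → ∈-allFin _)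

complete⇒length≥n : ∀ {n} {vs : List (Fin n)} → (∀ v → v ∈ˡ vs) → n ≤ length vs
complete⇒length≥n {n} {vs} full =
  subst (_≤ length vs) (length-tabulate {n = n} id) (unique-⊆⇒length≤ (allFin⁺ n) λ _ → full _)

length-concat-tabulate : ∀ {A : Set} {p} (f : Fin p → List A) →
                         length (concat (tabulate f)) ≡ sum (length ∘ f)
length-concat-tabulate {p = zero}  f = refl
length-concat-tabulate {p = suc p} f =
  trans (length-++ (f zero)) (cong (length (f zero) +_) (length-concat-tabulate (f ∘ suc)))

sum-const : ∀ p {c} (f : Fin p → ℕ) → (∀ i → f i ≡ c) → sum f ≡ p * c
sum-const zero    f eq = refl
sum-const (suc p) f eq = cong₂ _+_ (eq zero) (sum-const p (f ∘ suc) (eq ∘ suc))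

-- Subsets

elements : ∀ {n} → Subset n → List (Fin n)
elements []            = []
elements (inside ∷ p)  = zero ∷ map suc (elements p)
elements (outside ∷ p) = map suc (elements p)

length-elements : ∀ {n} (p : Subset n) → length (elements p) ≡ ∣ p ∣
length-elements []            = refl
length-elements (inside ∷ p)  = cong suc (trans (length-map suc (elements p)) (length-elements p))
length-elements (outside ∷ p) = trans (length-map suc (elements p)) (length-elements p)

∈-elements⁺ : ∀ {n} {p : Subset n} {x} → x ∈ p → x ∈ˡ elements p
∈-elements⁺ {p = inside ∷ p}  here        = here refl
∈-elements⁺ {p = inside ∷ p}  (there x∈p) = there (∈-map⁺ suc (∈-elements⁺ x∈p))
∈-elements⁺ {p = outside ∷ p} (there x∈p) = ∈-map⁺ suc (∈-elements⁺ x∈p)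

∈-elements⁻ : ∀ {n} {p : Subset n} {x} → x ∈ˡ elements p → x ∈ p
∈-elements⁻ {p = inside ∷ p} (here refl) = here
∈-elements⁻ {p = inside ∷ p} (there x∈) with ∈-map⁻ suc x∈
... | _ , y∈ , refl = there (∈-elements⁻ y∈)
∈-elements⁻ {p = outside ∷ p} x∈ with ∈-map⁻ suc x∈
... | _ , y∈ , refl = there (∈-elements⁻ y∈)

elements-unique : ∀ {n} (p : Subset n) → Unique (elements p)
elements-unique []            = []
elements-unique (inside ∷ p)  = ¬Any⇒All¬ _ zero∉ ∷ map⁺ suc-injective (elements-unique p)
  where
  zero∉ : zero ∉ˡ map suc (elements p)
  zero∉ z∈ with ∈-map⁻ suc z∈
  ... | _ , _ , ()
elements-unique (outside ∷ p) = map⁺ suc-injective (elements-unique p)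

∣p∪⁅y⁆∣≤1+∣p∣ : ∀ {n} (p : Subset n) y → ∣ p ∪ ⁅ y ⁆ ∣ ≤ suc ∣ p ∣
∣p∪⁅y⁆∣≤1+∣p∣ (inside ∷ p)  zero    = s≤s (m≤n⇒m≤1+n (≤-reflexive (cong ∣_∣ (∪-identityʳ p))))
∣p∪⁅y⁆∣≤1+∣p∣ (outside ∷ p) zero    = s≤s (≤-reflexive (cong ∣_∣ (∪-identityʳ p)))
∣p∪⁅y⁆∣≤1+∣p∣ (inside ∷ p)  (suc y) = s≤s (∣p∪⁅y⁆∣≤1+∣p∣ p y)
∣p∪⁅y⁆∣≤1+∣p∣ (outside ∷ p) (suc y) = ∣p∪⁅y⁆∣≤1+∣p∣ p y

superset-of-size : ∀ {n} k (p : Subset n) → ∣ p ∣ ≤ k → k ≤ n → ∃[ q ] p ⊆ q × ∣ q ∣ ≡ k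
superset-of-size {zero} zero [] _ _ = [] , id , refl
superset-of-size {suc n} (suc k) (inside ∷ p) (s≤s p≤k) (s≤s k≤n) =
  let q , p⊆q , eq = superset-of-size k p p≤k k≤n
  in inside ∷ q , (λ { here → here ; (there x∈) → there (p⊆q x∈) }) , cong suc eq
superset-of-size {suc n} k (outside ∷ p) p≤k k≤1+n with m≤n⇒m<n∨m≡n k≤1+n
... | inj₁ (s≤s k≤n) =
  let q , p⊆q , eq = superset-of-size k p p≤k k≤n
  in outside ∷ q , (λ { (there x∈) → there (p⊆q x∈) }) , eq
-- Leaving the first vertex out is impossible only when k is the full order, and then the superset
-- is everything.
... | inj₂ refl = ⊤ , (λ _ → ∈⊤) , ∣⊤∣≡n (suc n)

-- This reduces questions about k-sets to questions about pairs of vertices, which is why k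
-- disappears when ℓ = 1. The pair may be degenerate, x = y.
superset-of-pair : ∀ {n k} → 2 ≤ k → k ≤ n → (x y : Fin n) →
                   ∃[ S ] ∣ S ∣ ≡ k × x ∈ S × y ∈ S
superset-of-pair 2≤k k≤n x y =
  let S , ⊆S , eq = superset-of-size _ (⁅ x ⁆ ∪ ⁅ y ⁆) (≤-trans pair≤2 2≤k) k≤n
  in S , eq , ⊆S (p⊆p∪q ⁅ y ⁆ (x∈⁅x⁆ x)) , ⊆S (q⊆p∪q ⁅ x ⁆ ⁅ y ⁆ (x∈⁅x⁆ y))
  where
  pair≤2 : ∣ ⁅ x ⁆ ∪ ⁅ y ⁆ ∣ ≤ 2
  pair≤2 = ≤-trans (∣p∪⁅y⁆∣≤1+∣p∣ ⁅ x ⁆ y) (s≤s (≤-reflexive (∣⁅x⁆∣≡1 x)))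

-- Arcs of a digraph

Arc? : ∀ {n} (D : Digraph n) → Decidable (Arc D)
Arc? D x y = y ∈? N⁺ D x

arcsFrom : ∀ {n} → Digraph n → Fin n → List (Fin n × Fin n)
arcsFrom D x = map (x ,_) (elements (N⁺ D x))

arcs : ∀ {n} → Digraph n → List (Fin n × Fin n)
arcs D = concat (tabulate (arcsFrom D))

length-arcs : ∀ {n} (D : Digraph n) → length (arcs D) ≡ size D
length-arcs D = trans (length-concat-tabulate (arcsFrom D))
  (sum-cong-≗ λ x → trans (length-map (x ,_) (elements (N⁺ D x))) (length-elements (N⁺ D x)))

∈-arcs⁺ : ∀ {n} (D : Digraph n) {x y} → Arc D x y → (x , y) ∈ˡ arcs D
∈-arcs⁺ D {x} xy = ∈-concat⁺′ (∈-map⁺ (x ,_) (∈-elements⁺ xy)) (∈-tabulate⁺ {f = arcsFrom D} x)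

∈-arcs⁻ : ∀ {n} (D : Digraph n) {x y} → (x , y) ∈ˡ arcs D → Arc D x y
∈-arcs⁻ D xy∈ with ∈-concat⁻′ (tabulate (arcsFrom D)) xy∈
... | _ , xy∈row , row∈ with ∈-tabulate⁻ {f = arcsFrom D} row∈
... | u , refl with ∈-map⁻ (u ,_) xy∈row
... | _ , y∈ , refl = ∈-elements⁻ y∈

arcs-unique : ∀ {n} (D : Digraph n) → Unique (arcs D)
arcs-unique D = concat⁺
  (All-tabulate⁺ λ x → map⁺ ,-injectiveʳ (elements-unique (N⁺ D x)))
  (AllPairs.tabulate⁺ λ { u≢v (∈u , ∈v) → u≢v (tails ∈u ∈v) })
  where
  tails : ∀ {u v a} {ps qs : List _} → a ∈ˡ map (u ,_) ps → a ∈ˡ map (v ,_) qs → u ≡ v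
  tails ∈u ∈v with ∈-map⁻ _ ∈u | ∈-map⁻ _ ∈v
  ... | _ , _ , refl | _ , _ , refl = refl

size≤length : ∀ {n} (D : Digraph n) L → (∀ {x y} → Arc D x y → (x , y) ∈ˡ L) → size D ≤ length L
size≤length D L D⊆L = subst (_≤ length L) (length-arcs D)
  (unique-⊆⇒length≤ (arcs-unique D) (D⊆L ∘ ∈-arcs⁻ D))

length≤size : ∀ {n} (D : Digraph n) L → Unique L → (∀ {x y} → (x , y) ∈ˡ L → Arc D x y) → length L ≤ size D
length≤size D L L! L⊆D = subst (length L ≤_) (length-arcs D)
  (unique-⊆⇒length≤ L! (∈-arcs⁺ D ∘ L⊆D))

module _ {n} (D : Digraph n) (x y : Fin n) where

  deleteArc⁺ : ∀ {u v} → Arc D u v → (u , v) ≢ (x , y) → Arc (deleteArc D x y) u v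
  deleteArc⁺ {u} {v} uv uv≢xy with u ≟ x
  ... | yes refl = subst (v ∈_) (sym (updateAt-updates u (N⁺ D)))
    (x∈p∧x∉q⇒x∈p─q uv λ v∈ → uv≢xy (cong (u ,_) (x∈⁅y⁆⇒x≡y y v∈)))
  ... | no u≢x = subst (v ∈_) (sym (updateAt-minimal u x (N⁺ D) u≢x)) uv

  deleteArc⁻ : ∀ {u v} → Arc (deleteArc D x y) u v → Arc D u v
  deleteArc⁻ {u} {v} uv with u ≟ x
  ... | yes refl = p─q⊆p _ _ (subst (v ∈_) (updateAt-updates u (N⁺ D)) uv)
  ... | no u≢x = subst (v ∈_) (updateAt-minimal u x (N⁺ D) u≢x) uv

x∉p-x : ∀ {n} (p : Subset n) x → x ∉ p - x
x∉p-x (_ ∷ p) (suc x) (there x∈) = x∉p-x p x x∈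

deleteArc-deleted : ∀ {n} (D : Digraph n) x y → ¬ Arc (deleteArc D x y) x y
deleteArc-deleted D x y xy =
  x∉p-x (N⁺ D x) y (subst (y ∈_) (updateAt-updates x (N⁺ D)) xy)

-- Reachability

StronglyConnected : ∀ {n} → Rel (Fin n) 0ℓ → Set
StronglyConnected E = ∀ x y → Star E x y

Listed : ∀ {n} → List (Fin n × Fin n) → Rel (Fin n) 0ℓ
Listed L x y = (x , y) ∈ˡ L

-- Once vs contains every vertex, T is a spanning out-branching rooted at the seed.
data Grown {n} (E : Rel (Fin n) 0ℓ) (seed : List (Fin n)) :
           List (Fin n) → List (Fin n × Fin n) → Set where
  start : Grown E seed seed []
  grow  : ∀ {vs T u v} → Grown E seed vs T → u ∈ˡ vs → v ∉ˡ vs → E u v →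
          Grown E seed (v ∷ vs) ((u , v) ∷ T)

module _ {n} {E : Rel (Fin n) 0ℓ} {seed : List (Fin n)} where

  grown-length : ∀ {vs T} → Grown E seed vs T → length vs ≡ length T + length seed
  grown-length start           = refl
  grown-length (grow g _ _ _) = cong suc (grown-length g)

  grown-unique : ∀ {vs T} → Unique seed → Grown E seed vs T → Unique vs
  grown-unique seed! start             = seed!
  grown-unique seed! (grow g _ v∉ _) = ¬Any⇒All¬ _ v∉ ∷ grown-unique seed! g

  grown-seed : ∀ {vs T v} → Grown E seed vs T → v ∈ˡ seed → v ∈ˡ vs
  grown-seed start          v∈ = v∈
  grown-seed (grow g _ _ _) v∈ = there (grown-seed g v∈)

  grown-arcs : ∀ {vs T} → Grown E seed vs T → Listed T ⇒ E
  grown-arcs (grow _ _ _ uv) (here refl) = uv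
  grown-arcs (grow g _ _ _)  (there ab)  = grown-arcs g ab

  grown-reach : ∀ {vs T v} → Grown E seed vs T → v ∈ˡ vs →
                ∃[ s ] s ∈ˡ seed × Star (Listed T) s v
  grown-reach start v∈ = _ , v∈ , ε
  grown-reach (grow g u∈ _ _) (here refl) =
    let s , s∈ , su = grown-reach g u∈ in s , s∈ , Star-map there su ◅◅ return (here refl)
  grown-reach (grow g _ _ _) (there v∈) =
    let s , s∈ , sv = grown-reach g v∈ in s , s∈ , Star-map there sv

open module FinListMembership {n} = DecMembership (_≟_ {n}) using () renaming (_∈?_ to _∈ˡ?_)

Closed : ∀ {n} → Rel (Fin n) 0ℓ → List (Fin n) → Set
Closed E vs = ∀ {u v} → u ∈ˡ vs → E u v → v ∈ˡ vs

closed-star : ∀ {n} {E : Rel (Fin n) 0ℓ} {vs u v} → Closed E vs → u ∈ˡ vs → Star E u v → v ∈ˡ vs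
closed-star cl u∈ ε         = u∈
closed-star cl u∈ (e ◅ es) = closed-star cl (cl u∈ e) es

module _ {n} {E : Rel (Fin n) 0ℓ} (E? : Decidable E) {seed : List (Fin n)} (seed! : Unique seed) where

  Exit : List (Fin n) → Set
  Exit vs = ∃[ u ] ∃[ v ] u ∈ˡ vs × v ∉ˡ vs × E u v

  exit? : ∀ vs → Dec (Exit vs)
  exit? vs = any? λ u → any? λ v → (u ∈ˡ? vs) ×-dec (¬? (v ∈ˡ? vs) ×-dec E? u v)

  -- Each growth step trades one unit of fuel for one new vertex. Without fuel, the repetition-free
  -- list `vs` would have more than n vertices.
  complete-growth : ∀ fuel {vs T} → Grown E seed vs T → suc n ≤ fuel + length vs →
                    ∃[ vs′ ] ∃[ T′ ] Grown E seed vs′ T′ × Closed E vs′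
  complete-growth zero g n<vs =
    contradiction (≤-trans n<vs (unique⇒length≤n (grown-unique seed! g))) (<-irrefl refl)
  complete-growth (suc fuel) {vs} g n<vs with exit? vs
  ... | yes (_ , _ , u∈ , v∉ , uv) =
    complete-growth fuel (grow g u∈ v∉ uv) (subst (suc n ≤_) (sym (+-suc fuel (length vs))) n<vs)
  ... | no none = vs , _ , g , λ {_} {v} u∈ uv →
    decidable-stable (v ∈ˡ? vs) λ v∉ → none (_ , _ , u∈ , v∉ , uv)

  closure : ∃[ vs ] ∃[ T ] Grown E seed vs T × Closed E vs
  closure = complete-growth (suc n) start (s≤s (m≤m+n n (length seed)))

-- The vertices grown from the single seed x form a closed list, so they are exactly those reachable
-- from x. Decidability later allows a path to be extracted from a double negation.
reachable? : ∀ {n} {E : Rel (Fin n) 0ℓ} → Decidable E → Decidable (Star E)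
reachable? E? x y with closure E? {x ∷ []} ([] ∷ [])
... | vs , T , g , cl = map′ reach (closed-star cl (grown-seed g (here refl))) (y ∈ˡ? vs)
  where
  reach : y ∈ˡ vs → Star _ x y
  reach y∈ with grown-reach g y∈
  ... | _ , here refl , xy = Star-map (grown-arcs g) xy

record Branching {n} (E : Rel (Fin n) 0ℓ) (seed : List (Fin n)) : Set where
  field
    vertices : List (Fin n)
    branch   : List (Fin n × Fin n)
    grown    : Grown E seed vertices branch
    spanning : ∀ v → v ∈ˡ vertices

  length-vertices : Unique seed → length vertices ≡ n
  length-vertices seed! =
    ≤-antisym (unique⇒length≤n (grown-unique seed! grown)) (complete⇒length≥n spanning)

  length-branch : Unique seed → length branch + length seed ≡ n
  length-branch seed! = trans (sym (grown-length grown)) (length-vertices seed!)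

branching : ∀ {n} {E : Rel (Fin n) 0ℓ} → Decidable E → StronglyConnected E →
            ∀ {seed r} → Unique seed → r ∈ˡ seed → Branching E seed
branching E? strong seed! r∈ =
  let vs , T , g , cl = closure E? seed!
  in record { grown = g ; spanning = λ v → closed-star cl (grown-seed g r∈) (strong _ v) }

-- An out-branching and an in-branching, both rooted at a strong seed, together
-- with the arcs of the seed form a strong spanning subgraph.
sparse-spanning : ∀ {n} {E : Rel (Fin n) 0ℓ} → Decidable E → StronglyConnected E →
  ∀ {seed r L₀} → Unique seed → r ∈ˡ seed → Listed L₀ ⇒ E →
  (∀ {u v} → u ∈ˡ seed → v ∈ˡ seed → Star (Listed L₀) u v) →
  ∃[ L ] (Listed L ⇒ E) × StronglyConnected (Listed L)
       × length L + 2 * length seed ≡ length L₀ + 2 * n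
sparse-spanning {n} {E} E? strong {seed} {r} {L₀} seed! r∈ L₀⊆E seed-strong =
  L , L⊆E , L-strong , L-length
  where
  module Out = Branching (branching E? strong seed! r∈)
  -- An in-branching is an out-branching of the reversed relation; its arcs are swapped back in `L`.
  module In  = Branching (branching {E = flip E} (flip E?) (λ x y → reverse id (strong y x)) seed! r∈)

  L = L₀ ++ (Out.branch ++ map swap In.branch)

  L⊆E : Listed L ⇒ E
  L⊆E ab with ∈-++⁻ L₀ ab
  ... | inj₁ ab₀ = L₀⊆E ab₀
  ... | inj₂ ab′ with ∈-++⁻ Out.branch ab′
  ... | inj₁ ab⁺ = grown-arcs Out.grown ab⁺
  ... | inj₂ ab⁻ with ∈-map⁻ swap ab⁻
  ... | _ , ba , refl = grown-arcs In.grown ba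

  in⊆L : ∀ {a b} → (b , a) ∈ˡ In.branch → (a , b) ∈ˡ L
  in⊆L ba = ∈-++⁺ʳ L₀ (∈-++⁺ʳ Out.branch (∈-map⁺ swap ba))

  L-strong : StronglyConnected (Listed L)
  -- Follow the in-branching from x to the seed, cross the seed by arcs of `L₀`, then follow the
  -- out-branching to y.
  L-strong x y =
    let s , s∈ , sx = grown-reach In.grown (In.spanning x)
        t , t∈ , ty = grown-reach Out.grown (Out.spanning y)
    in reverse in⊆L sx ◅◅ Star-map ∈-++⁺ˡ (seed-strong s∈ t∈)
         ◅◅ Star-map (∈-++⁺ʳ L₀ ∘ ∈-++⁺ˡ) ty

  rearrange : ∀ a b c s → (a + (b + c)) + 2 * s ≡ a + ((b + s) + (c + s))
  rearrange = solve-∀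

  double : ∀ m → m + m ≡ 2 * m
  double = solve-∀

  -- Each of the two branchings has n minus the seed length many arcs. The additive form avoids
  -- truncated subtraction.
  L-length : length L + 2 * length seed ≡ length L₀ + 2 * n
  L-length = begin
    length L + 2 * length seed
      ≡⟨ cong (_+ 2 * length seed) (trans (length-++ L₀) (cong (length L₀ +_)
           (trans (length-++ Out.branch) (cong (length Out.branch +_) (length-map swap In.branch))))) ⟩
    (length L₀ + (length Out.branch + length In.branch)) + 2 * length seed
      ≡⟨ rearrange (length L₀) (length Out.branch) (length In.branch) (length seed) ⟩
    length L₀ + ((length Out.branch + length seed) + (length In.branch + length seed))
      ≡⟨ cong (length L₀ +_) (trans (cong₂ _+_ (Out.length-branch seed!) (In.length-branch seed!)) (double n)) ⟩
    length L₀ + 2 * n ∎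
    where open ≡-Reasoning

2*[1+n]≡2*n+2 : ∀ n → 2 * suc n ≡ 2 * n + 2
2*[1+n]≡2*n+2 = solve-∀

sparse-spanning-from-vertex : ∀ {n} {E : Rel (Fin n) 0ℓ} → Decidable E → StronglyConnected E → Fin n →
  ∃[ L ] (Listed L ⇒ E) × StronglyConnected (Listed L) × length L ≡ 2 * (n ∸ 1)
sparse-spanning-from-vertex {suc n} E? strong r =
  let L , L⊆E , L-strong , eq = sparse-spanning E? strong {r ∷ []} {r} {[]} ([] ∷ []) (here refl) (λ ())
                                  λ { (here refl) (here refl) → ε }
  in L , L⊆E , L-strong , +-cancelʳ-≡ 2 _ _ (trans eq (2*[1+n]≡2*n+2 n))

-- Walks

-- A walk with vertices x ∷ ws, ending in y.
data Walk {n} (E : Rel (Fin n) 0ℓ) : Fin n → List (Fin n) → Fin n → Set where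
  []  : ∀ {x} → Walk E x [] x
  _∷_ : ∀ {x z ws y} → E x z → Walk E z ws y → Walk E x (z ∷ ws) y

-- A suffix of a simple walk is simple. `simple-walk` uses this to drop the loop when a newly
-- prepended vertex already occurs.
cut : ∀ {n} {E : Rel (Fin n) 0ℓ} {x ws y u} → Walk E x ws y → Unique (x ∷ ws) → u ∈ˡ x ∷ ws →
      ∃[ ws′ ] Walk E u ws′ y × Unique (u ∷ ws′)
cut w       ws!       (here refl) = _ , w , ws!
cut (_ ∷ w) (_ ∷ ws!) (there u∈)  = cut w ws! u∈

simple-walk : ∀ {n} {E : Rel (Fin n) 0ℓ} {x y} → Star E x y → ∃[ ws ] Walk E x ws y × Unique (x ∷ ws)
simple-walk ε = [] , [] , [] ∷ []
simple-walk {x = x} (_◅_ {j = z} e es) with simple-walk es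
... | ws , w , ws! with x ∈ˡ? (z ∷ ws)
... | yes x∈ = cut w ws! x∈
... | no x∉  = z ∷ ws , e ∷ w , ¬Any⇒All¬ _ x∉ ∷ ws!

walk-step : ∀ {n} {E : Rel (Fin n) 0ℓ} {x ws y} → Walk E x ws y →
            ∀ (i : Fin (length ws)) → E (lookup (x ∷ ws) (inject₁ i)) (lookup (x ∷ ws) (suc i))
walk-step (e ∷ w) zero    = e
walk-step (e ∷ w) (suc i) = walk-step w i

walk-last : ∀ {n} {E : Rel (Fin n) 0ℓ} {x ws y} → Walk E x ws y →
            lookup (x ∷ ws) (fromℕ (length ws)) ≡ y
walk-last []      = refl
walk-last (_ ∷ w) = walk-last w

walkArcs : ∀ {n} → Fin n → List (Fin n) → List (Fin n × Fin n)
walkArcs x []       = []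
walkArcs x (z ∷ ws) = (x , z) ∷ walkArcs z ws

length-walkArcs : ∀ {n} (x : Fin n) ws → length (walkArcs x ws) ≡ length ws
length-walkArcs x []       = refl
length-walkArcs x (z ∷ ws) = cong suc (length-walkArcs z ws)

module _ {n} {E : Rel (Fin n) 0ℓ} where

  walkArcs⊆ : ∀ {x ws y} → Walk E x ws y → Listed (walkArcs x ws) ⇒ E
  walkArcs⊆ (e ∷ w) (here refl) = e
  walkArcs⊆ (e ∷ w) (there ab)  = walkArcs⊆ w ab

  from-start : ∀ {x ws y u} → Walk E x ws y → u ∈ˡ x ∷ ws → Star (Listed (walkArcs x ws)) x u
  from-start w       (here refl) = ε
  from-start (_ ∷ w) (there u∈)  = here refl ◅ Star-map there (from-start w u∈)

  to-end : ∀ {x ws y u} → Walk E x ws y → u ∈ˡ x ∷ ws → Star (Listed (walkArcs x ws)) u y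
  to-end []      (here refl) = ε
  to-end (_ ∷ w) (here refl) = here refl ◅ Star-map there (to-end w (here refl))
  to-end (_ ∷ w) (there u∈)  = Star-map there (to-end w u∈)

-- Minimally strong digraphs

-- The form of `𝔉 n k 1` that is free of k. Criticality is tested only between the ends of the
-- deleted arc: if a detour existed there, every other path could use it in place of the arc.
MinStrong : ∀ {n} → Digraph n → Set
MinStrong D = StronglyConnected (Arc D)
            × (∀ {x y} → Arc D x y → ¬ Star (Arc (deleteArc D x y)) x y)

open module ArcListMembership {n} =
  DecMembership (≡-dec (_≟_ {n}) (_≟_ {n})) using () renaming (_∈?_ to _∈ᵃ?_)

-- An arc xy missing from `L` would have a detour inside `L`, which survives the deletion of xy.
-- Hence `L` contains every arc of D.
minStrong-size≤ : ∀ {n} (D : Digraph n) {L} → MinStrong D → Listed L ⇒ Arc D →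
                  StronglyConnected (Listed L) → size D ≤ length L
minStrong-size≤ D {L} (_ , bridge) L⊆D L-strong =
  size≤length D L λ {x} {y} xy → decidable-stable ((x , y) ∈ᵃ? L) λ xy∉L →
    bridge xy (Star-map (λ ab → deleteArc⁺ D x y (L⊆D ab) λ { refl → xy∉L ab }) (L-strong x y))

minStrong-size≤2[n-1] : ∀ {n} (D : Digraph n) → MinStrong D → Fin n → size D ≤ 2 * (n ∸ 1)
minStrong-size≤2[n-1] D min r =
  let L , L⊆D , L-strong , eq = sparse-spanning-from-vertex (Arc? D) (proj₁ min) r
  in ≤-trans (minStrong-size≤ D min L⊆D L-strong) (≤-reflexive eq)

-- A directed cycle of length c is a strong seed with as many arcs as vertices,
-- which leaves 2n − c arcs instead of 2n − 2.
minStrong-long-cycle : ∀ {n} (D : Digraph n) {x ws y} → MinStrong D →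
  Walk (Arc D) x ws y → Unique (x ∷ ws) → 2 ≤ length ws → Arc D y x → size D < 2 * (n ∸ 1)
minStrong-long-cycle {suc n} D {x} {ws} {y} min w ws! 2≤r yx =
  let L , L⊆D , L-strong , eq = sparse-spanning (Arc? D) (proj₁ min) ws! (here refl) L₀⊆D seed-strong
      -- Both `L₀` and the seed have c = `suc (length ws)` entries, so length L + 2c = c + 2 (suc n)
      -- and one c cancels. Strictness then comes from c ≥ 3; with c = 2 the bound would be 2n
      -- itself.
      L+1+r≡ = +-cancelʳ-≡ (suc (length ws)) (length L + suc (length ws)) (2 * suc n)
                 (trans (regroup (length L) (length ws)) (trans eq
                   (trans (cong (λ a → suc a + 2 * suc n) (length-walkArcs x ws)) (+-comm (suc (length ws)) (2 * suc n)))))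
  in ≤-trans (s≤s (minStrong-size≤ D min L⊆D L-strong))
       (+-cancelʳ-≤ 2 (suc (length L)) (2 * n) (begin
         suc (length L) + 2       ≡⟨ shift (length L) ⟩
         length L + 3             ≤⟨ +-monoʳ-≤ (length L) (s≤s 2≤r) ⟩
         length L + suc (length ws) ≡⟨ L+1+r≡ ⟩
         2 * suc n                ≡⟨ 2*[1+n]≡2*n+2 n ⟩
         2 * n + 2 ∎))
  where
  open ≤-Reasoning
  L₀ = (y , x) ∷ walkArcs x ws

  L₀⊆D : Listed L₀ ⇒ Arc D
  L₀⊆D (here refl) = yx
  L₀⊆D (there ab)  = walkArcs⊆ w ab

  seed-strong : ∀ {u v} → u ∈ˡ x ∷ ws → v ∈ˡ x ∷ ws → Star (Listed L₀) u v
  -- Go on to the end y of the walk, return by the arc yx, and walk from x to v.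
  seed-strong u∈ v∈ = Star-map there (to-end w u∈) ◅◅ (here refl ◅ Star-map there (from-start w v∈))

  regroup : ∀ l r → (l + suc r) + suc r ≡ l + 2 * suc r
  regroup = solve-∀
  shift : ∀ l → suc l + 2 ≡ l + 3
  shift = solve-∀

-- Extremal digraphs, symmetry and trees

extremal⇒symmetric : ∀ {n} (D : Digraph n) → MinStrong D → 2 * (n ∸ 1) ≤ size D → SymmetricDigraph D
extremal⇒symmetric D min large {x} {y} xy with simple-walk (proj₁ min y x)
... | _ , []           , _   = contradiction xy (loopless D x)
... | _ , yx ∷ []      , _   = yx
-- A simple walk back from y with at least two arcs closes with xy to a directed cycle of length at
-- least 3, which makes D too small.
... | _ , w@(_ ∷ _ ∷ _) , ws! =
  contradiction (≤-trans (minStrong-long-cycle D min w ws! (s≤s (s≤s z≤n)) xy) large) (<-irrefl refl)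

path-star : ∀ {A : Set} {E : Rel A 0ℓ} r (c : Fin (suc r) → A) →
            (∀ i → E (c (inject₁ i)) (c (suc i))) → Star E (c zero) (c (fromℕ r))
path-star zero    c step = ε
path-star (suc r) c step = step zero ◅ path-star r (c ∘ suc) (step ∘ suc)

-- By symmetry the cycle can be directed either way, so the path c₀ ... c_r is a detour for the arc
-- from c₀ to c_r.
minStrong-symmetric⇒acyclic : ∀ {n} (D : Digraph n) → MinStrong D → SymmetricDigraph D →
                              ¬ Cycle (underlying D)
minStrong-symmetric⇒acyclic D (_ , bridge) D-sym C =
  bridge (directed (symmetric (underlying D) close))
    (path-star r c λ i → deleteArc⁺ D (c zero) (c (fromℕ r)) (directed (step i)) (not-closing 2≤r i ∘ injective i))
  where
  open Cycle C
  directed : ∀ {u v} → Arc D u v ⊎ Arc D v u → Arc D u v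
  directed = [ id , D-sym ]

  injective : ∀ i → (c (inject₁ i) , c (suc i)) ≡ (c zero , c (fromℕ r)) →
              inject₁ i ≡ zero × suc i ≡ fromℕ r
  injective i eq = c-inj (,-injectiveˡ eq) , c-inj (,-injectiveʳ eq)

  -- With r = 1 the only step of the path would be the arc being avoided; here `2 ≤ r` enters.
  not-closing : ∀ {r} → 2 ≤ r → (i : Fin r) → ¬ (inject₁ i ≡ zero × suc i ≡ fromℕ r)
  not-closing (s≤s (s≤s _)) zero    (_ , ())
  not-closing (s≤s (s≤s _)) (suc i) (() , _)

extremal⇒tree : ∀ {n} (D : Digraph n) → MinStrong D → 2 * (n ∸ 1) ≤ size D →
                SymmetricDigraph D × IsTree (underlying D)
extremal⇒tree D min large =
  let D-sym = extremal⇒symmetric D min large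
  in D-sym , (λ x y → Star-map inj₁ (proj₁ min x y)) , minStrong-symmetric⇒acyclic D min D-sym

-- A simple detour for xy cannot be the deleted arc itself, so it has at least two arcs; together
-- with the edge xy it would be a cycle of the tree.
tree⇒minStrong : ∀ {n} (D : Digraph n) → SymmetricDigraph D → IsTree (underlying D) → MinStrong D
tree⇒minStrong D D-sym (connected , acyclic) =
  (λ x y → Star-map [ id , D-sym ] (connected x y)) , bridge
  where
  bridge : ∀ {x y} → Arc D x y → ¬ Star (Arc (deleteArc D x y)) x y
  bridge {x} {y} xy path with simple-walk path
  ... | _ , []      , _ = loopless D x xy
  ... | _ , e ∷ []  , _ = deleteArc-deleted D x y e
  ... | ws , w@(_ ∷ _ ∷ _) , ws! = acyclic record
    { r     = length ws
    ; 2≤r   = s≤s (s≤s z≤n)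
    ; c     = lookup (x ∷ ws)
    ; c-inj = unique⇒lookup-injective ws!
    ; step  = λ i → inj₁ (deleteArc⁻ D x y (walk-step w i))
    ; close = subst (λ v → Edge (underlying D) v x) (sym (walk-last w)) (inj₂ xy)
    }

twoWay : ∀ {n} → List (Fin n × Fin n) → List (Fin n × Fin n)
twoWay []            = []
twoWay ((u , v) ∷ T) = (u , v) ∷ (v , u) ∷ twoWay T

length-twoWay : ∀ {n} (T : List (Fin n × Fin n)) → length (twoWay T) ≡ 2 * length T
length-twoWay []      = refl
length-twoWay (_ ∷ T) = trans (cong (2 +_) (length-twoWay T)) (sym (*-suc 2 (length T)))

twoWay-endpoints : ∀ {n} {E : Rel (Fin n) 0ℓ} {seed vs T} → Grown E seed vs T →
                   ∀ {a b} → (a , b) ∈ˡ twoWay T → a ∈ˡ vs × b ∈ˡ vs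
twoWay-endpoints (grow g u∈ _ _) (here refl)         = there u∈ , here refl
twoWay-endpoints (grow g u∈ _ _) (there (here refl)) = here refl , there u∈
twoWay-endpoints (grow g _ _ _)  (there (there ab))  =
  let a∈ , b∈ = twoWay-endpoints g ab in there a∈ , there b∈

-- The two arcs added at each growth step meet the new vertex v, whereas all earlier arcs have both
-- ends among the old vertices.
twoWay-unique : ∀ {n} {E : Rel (Fin n) 0ℓ} {seed vs T} → Grown E seed vs T → Unique (twoWay T)
twoWay-unique start = []
twoWay-unique (grow g u∈ v∉ _) =
  ((λ { refl → v∉ u∈ }) ∷ ¬Any⇒All¬ _ (v∉ ∘ proj₂ ∘ twoWay-endpoints g)) ∷
  ¬Any⇒All¬ _ (v∉ ∘ proj₁ ∘ twoWay-endpoints g) ∷ twoWay-unique g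

twoWay-arcs : ∀ {n} {E : Rel (Fin n) 0ℓ} {seed vs T} → Symmetric E → Grown E seed vs T →
              Listed (twoWay T) ⇒ E
twoWay-arcs E-sym (grow _ _ _ uv) (here refl)         = uv
twoWay-arcs E-sym (grow _ _ _ uv) (there (here refl)) = E-sym uv
twoWay-arcs E-sym (grow g _ _ _)  (there (there ab))  = twoWay-arcs E-sym g ab

-- A spanning out-branching has one arc fewer than there are vertices, and symmetry supplies the
-- reversals, which are distinct from its arcs and from each other.
symmetric-size≥ : ∀ {n} (D : Digraph n) → StronglyConnected (Arc D) → SymmetricDigraph D → Fin n →
                  2 * (n ∸ 1) ≤ size D
symmetric-size≥ {suc n} D strong D-sym r =
  subst (_≤ size D) (trans (length-twoWay branch) (cong (2 *_) branch≡n))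
    (length≤size D (twoWay branch) (twoWay-unique grown) (twoWay-arcs D-sym grown))
  where
  open Branching (branching (Arc? D) strong {r ∷ []} ([] ∷ []) (here refl))
  branch≡n : length branch ≡ n
  branch≡n = +-cancelʳ-≡ 1 _ _ (trans (length-branch ([] ∷ [])) (+-comm 1 n))

-- Strong subgraph connectivity

first-step : ∀ {A : Set} {E : Rel A 0ℓ} {x y} → x ≢ y → Star E x y → ∃ (E x)
first-step x≢y ε       = contradiction refl x≢y
first-step x≢y (e ◅ _) = _ , e

whole : ∀ {n} (D : Digraph n) → Subgraph D
whole D .V          = ⊤
whole D .A⁺         = N⁺ D
whole D .A⁺⊆N⁺ _    = id
whole D .tail∈V _   = ∈⊤
whole D .head∈V _   = ∈⊤

strong⇒disjoint1 : ∀ {n} {D : Digraph n} S → StronglyConnected (Arc D) → InternallyDisjoint D S 1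
strong⇒disjoint1 {D = D} S strong = record
  { member           = λ _ → whole D
  ; strong           = λ _ _ _ → strong _ _
  ; containsS        = λ _ → ⊆⊤
  ; internallyVertex = λ { {zero} {zero} () }
  ; arcDisjoint      = λ { {zero} {zero} () }
  }

disjoint0 : ∀ {n} {D : Digraph n} S → InternallyDisjoint D S 0
disjoint0 S = record
  { member = λ () ; strong = λ () ; containsS = λ ()
  ; internallyVertex = λ { {()} } ; arcDisjoint = λ { {()} } }

disjoint-path : ∀ {n} {D : Digraph n} {S p x y} → x ∈ S → y ∈ S →
                InternallyDisjoint D S (suc p) → Star (Arc D) x y
disjoint-path x∈S y∈S fam = Star-map (A⁺⊆N⁺ (member zero) _) (strong zero (containsS zero x∈S) (containsS zero y∈S))
  where open InternallyDisjoint fam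

-- The members of a family leave x by pairwise distinct arcs.
disjoint-bounded : ∀ {n} {D : Digraph n} {S p x y} → x ≢ y → x ∈ S → y ∈ S →
                   InternallyDisjoint D S p → p ≤ n
disjoint-bounded {p = p} {x} {y} x≢y x∈S y∈S fam = injective⇒≤ {f = proj₁ ∘ next} next-injective
  where
  open InternallyDisjoint fam
  next : ∀ i → ∃ (SubArc (member i) x)
  next i = first-step x≢y (strong i (containsS i x∈S) (containsS i y∈S))

  next-injective : ∀ {i j} → proj₁ (next i) ≡ proj₁ (next j) → i ≡ j
  next-injective {i} {j} eq with <ᶠ-cmp i j
  ... | tri< i<j _ _ = contradiction (proj₂ (next j))
                         (arcDisjoint i<j (proj₂ (next i)) ∘ subst (SubArc (member j) x) (sym eq))
  ... | tri≈ _ i≡j _ = i≡j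
  ... | tri> _ _ j<i = contradiction (proj₂ (next i))
                         (arcDisjoint j<i (proj₂ (next j)) ∘ subst (SubArc (member i) x) eq)

-- Descent from the bound B. Since P need not be decidable, excluded middle is invoked at each value
-- under a double negation; this suffices for stable goals.
¬¬-maximum : ∀ {P : ℕ → Set} B → P 0 → (∀ p → P p → p ≤ B) → ¬ ¬ ∃ (IsMaximum P)
¬¬-maximum zero    P0 bound k = k (0 , P0 , bound)
¬¬-maximum {P} (suc B) P0 bound k = ¬¬-excluded-middle {A = P (suc B)} λ
  { (yes PB) → k (suc B , PB , bound)
  ; (no ¬PB) → ¬¬-maximum B P0 (λ p Pp → ≤-pred (≤∧≢⇒< (bound p Pp) λ { refl → ¬PB Pp })) k }

κ-positive⇒strong : ∀ {n k m} {D : Digraph n} → 2 ≤ k → k ≤ n → κ≡ k D m → 1 ≤ m →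
                    StronglyConnected (Arc D)
κ-positive⇒strong {n} {D = D} 2≤k k≤n (_ , minimal) 1≤m x y with x ≟ y
... | yes refl = ε
... | no x≢y with superset-of-pair 2≤k k≤n x y
-- The minimum bounds the value at `S` only once `κS≡ D S` is known to have one. That existence is
-- available doubly negated, and the goal is decidable.
... | S , ∣S∣≡k , x∈S , y∈S = decidable-stable (reachable? (Arc? D) x y)
  (¬¬-map path (¬¬-maximum n (disjoint0 S) λ _ → disjoint-bounded x≢y x∈S y∈S))
  where
  path : ∃ (κS≡ D S) → Star (Arc D) x y
  path (p , κS) with ≤-trans 1≤m (minimal p (S , ∣S∣≡k , κS))
  path (suc p , fam , _) | s≤s _ = disjoint-path x∈S y∈S fam

κ-zero⇒¬strong : ∀ {n k m} {D : Digraph n} → κ≡ k D m → m < 1 → ¬ StronglyConnected (Arc D)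
κ-zero⇒¬strong ((S , _ , _ , maximal) , _) (s≤s z≤n) strong with maximal 1 (strong⇒disjoint1 S strong)
... | ()

separated⇒κ≡0 : ∀ {n k x y} {D : Digraph n} → 2 ≤ k → k ≤ n → ¬ Star (Arc D) x y → κ≡ k D 0
separated⇒κ≡0 {x = x} {y} {D} 2≤k k≤n sep =
  let S , ∣S∣≡k , x∈S , y∈S = superset-of-pair 2≤k k≤n x y
  in (S , ∣S∣≡k , disjoint0 S , λ { zero _ → z≤n ; (suc _) fam → contradiction (disjoint-path x∈S y∈S fam) sep })
   , λ _ _ → z≤n

-- If S contains x and y, every member of a family must use the arc xy, and arc-disjointness leaves
-- room for one member. The whole digraph gives at least 1 for every S.
bridge⇒κ≡1 : ∀ {n k x y} {D : Digraph n} → 2 ≤ k → k ≤ n → StronglyConnected (Arc D) →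
             ¬ Star (Arc (deleteArc D x y)) x y → κ≡ k D 1
bridge⇒κ≡1 {x = x} {y} {D} 2≤k k≤n D-strong bridge =
  let S , ∣S∣≡k , x∈S , y∈S = superset-of-pair 2≤k k≤n x y
  in (S , ∣S∣≡k , strong⇒disjoint1 S D-strong , λ _ → at-most-one x∈S y∈S)
   , λ { _ (S′ , _ , _ , maximal) → maximal 1 (strong⇒disjoint1 S′ D-strong) }
  where
  uses-xy : ∀ (H : Subgraph D) → Star (SubArc H) x y → SubArc H x y
  uses-xy H path = decidable-stable (y ∈? A⁺ H x) λ xy∉ →
    bridge (Star-map (λ ab → deleteArc⁺ D x y (A⁺⊆N⁺ H _ ab) λ { refl → xy∉ ab }) path)

  at-most-one : ∀ {S p} → x ∈ S → y ∈ S → InternallyDisjoint D S p → p ≤ 1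
  at-most-one {p = zero}        _ _ _ = z≤n
  at-most-one {p = suc zero}    _ _ _ = s≤s z≤n
  at-most-one {p = suc (suc p)} x∈S y∈S fam =
    contradiction (shared (suc zero)) (arcDisjoint {zero} {suc zero} (s≤s z≤n) (shared zero))
    where
    open InternallyDisjoint fam
    shared : ∀ i → SubArc (member i) x y
    shared i = uses-xy (member i) (strong i (containsS i x∈S) (containsS i y∈S))

minStrong⇒𝔉 : ∀ {n k} {D : Digraph n} → 2 ≤ k → k ≤ n → MinStrong D → 𝔉 n k 1 D
minStrong⇒𝔉 {D = D} 2≤k k≤n (strong , bridge) with ≤-trans 2≤k k≤n
... | s≤s (s≤s _) =
  -- The exact value 1 requires some arc to serve as a bridge; one leaves `zero`, as there are at
  -- least two vertices.
  let _ , arc = first-step {x = zero} {y = suc zero} (λ ()) (strong _ _)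
  in (1 , bridge⇒κ≡1 2≤k k≤n strong (bridge arc) , ≤-refl)
   , λ xy → 0 , separated⇒κ≡0 2≤k k≤n (bridge xy) , s≤s z≤n

-- A detour for xy would let every path of D be rerouted, so D - xy would stay strong and keep
-- positive connectivity.
𝔉⇒minStrong : ∀ {n k} {D : Digraph n} → 2 ≤ k → k ≤ n → 𝔉 n k 1 D → MinStrong D
𝔉⇒minStrong {D = D} 2≤k k≤n ((_ , κD , 1≤m) , critical) = strong , bridge
  where
  strong = κ-positive⇒strong 2≤k k≤n κD 1≤m

  bridge : ∀ {x y} → Arc D x y → ¬ Star (Arc (deleteArc D x y)) x y
  bridge {x} {y} xy detour =
    let _ , κD-xy , m<1 = critical xy
    in κ-zero⇒¬strong κD-xy m<1 λ u v → (reroute ⋆) (strong u v)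
    where
    reroute : Arc D ⇒ Star (Arc (deleteArc D x y))
    reroute {a} {b} ab with ≡-dec _≟_ _≟_ (a , b) (x , y)
    ... | yes refl = detour
    ... | no ab≢xy = return (deleteArc⁺ D x y ab ab≢xy)

-- The symmetric star

-- The witness that `𝔉` is nonempty and that the bound is attained for ℓ = 1, with centre `zero`.
star : ∀ n → Digraph (suc n)
star n .N⁺ zero    = ⊤ - zero
star n .N⁺ (suc _) = ⁅ zero ⁆
star n .loopless zero    = x∉p-x ⊤ zero
star n .loopless (suc i) = 0≢1+n ∘ sym ∘ x∈⁅y⁆⇒x≡y zero

star-out : ∀ {n} (i : Fin n) → Arc (star n) zero (suc i)
star-out i = x∈p∧x∉q⇒x∈p─q ∈⊤ λ i∈ → contradiction (x∈⁅y⁆⇒x≡y zero i∈) λ ()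

star-in : ∀ {n} (i : Fin n) → Arc (star n) (suc i) zero
star-in i = x∈⁅x⁆ zero

star-symmetric : ∀ n → SymmetricDigraph (star n)
star-symmetric n {zero}  {zero}  zz = contradiction zz (x∉p-x ⊤ zero)
star-symmetric n {zero}  {suc i} _  = star-in i
star-symmetric n {suc i} {zero}  _  = star-out i
star-symmetric n {suc i} {suc j} ij = contradiction (x∈⁅y⁆⇒x≡y zero ij) λ ()

star-minStrong : ∀ n → MinStrong (star n)
star-minStrong n = (λ x y → to-centre x ◅◅ from-centre y) , bridge
  where
  to-centre : ∀ x → Star (Arc (star n)) x zero
  to-centre zero    = ε
  to-centre (suc i) = return (star-in i)

  from-centre : ∀ y → Star (Arc (star n)) zero y
  from-centre zero    = ε
  from-centre (suc i) = return (star-out i)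

  -- The only arc into the leaf is the deleted one, so a walk starting elsewhere stays off the leaf.
  unreachable : ∀ {i u} → u ≢ suc i → ¬ Star (Arc (deleteArc (star n) zero (suc i))) u (suc i)
  unreachable u≢ ε = u≢ refl
  unreachable {i} {u} u≢ (_◅_ {j = w} e es) = unreachable (enters u e) es
    where
    enters : ∀ u → Arc (deleteArc (star n) zero (suc i)) u w → w ≢ suc i
    enters zero    e refl = deleteArc-deleted (star n) zero (suc i) e
    enters (suc j) e refl = contradiction (x∈⁅y⁆⇒x≡y zero (deleteArc⁻ (star n) zero (suc i) {suc j} e)) λ ()

  bridge : ∀ {x y} → Arc (star n) x y → ¬ Star (Arc (deleteArc (star n) x y)) x y
  bridge {zero}  {zero}  zz _ = loopless (star n) zero zz
  bridge {zero}  {suc i} _    = unreachable λ ()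
  bridge {suc i} {suc j} ij _ = contradiction (x∈⁅y⁆⇒x≡y zero ij) λ ()
  -- A leaf has the centre as its only out-neighbour, so a detour would begin with the deleted arc.
  bridge {suc i} {zero}  _ (_◅_ {j = w} e _)
    with x∈⁅y⁆⇒x≡y zero (deleteArc⁻ (star n) (suc i) zero {suc i} {w} e)
  ... | refl = deleteArc-deleted (star n) (suc i) zero e

star-size : ∀ n → size (star n) ≡ 2 * n
star-size n = ≤-antisym (minStrong-size≤2[n-1] (star n) (star-minStrong n) zero)
  (symmetric-size≥ (star n) (proj₁ (star-minStrong n)) (star-symmetric n) zero)

-- The value of F and the extremal digraphs for ℓ = 1

F[n,k,1] : ∀ n k → 2 ≤ k → k ≤ n → F≡ n k 1 (2 * (n ∸ 1))
F[n,k,1] n k 2≤k k≤n with ≤-trans 2≤k k≤n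
... | s≤s {n = n′} _ = (star n′ , minStrong⇒𝔉 2≤k k≤n (star-minStrong n′) , star-size n′)
  , λ { _ (D , D∈𝔉 , refl) → minStrong-size≤2[n-1] D (𝔉⇒minStrong 2≤k k≤n D∈𝔉) zero }

Ex[n,k,1] : ∀ n k → 2 ≤ k → k ≤ n → (D : Digraph n) →
            Ex n k 1 D ⇔ (SymmetricDigraph D × IsTree (underlying D))
Ex[n,k,1] n k 2≤k k≤n D = mk⇔
  (λ { (D∈𝔉 , _ , maximal) →
       -- Maximality of `size D` is compared with the size attained by the star.
       extremal⇒tree D (𝔉⇒minStrong 2≤k k≤n D∈𝔉) (maximal (2 * (n ∸ 1)) (proj₁ F-value)) })
  (λ { (D-sym , D-tree) →
       let min = tree⇒minStrong D D-sym D-tree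
       in minStrong⇒𝔉 2≤k k≤n min , subst (F≡ n k 1) (sym (tree-size min D-sym)) F-value })
  where
  F-value = F[n,k,1] n k 2≤k k≤n

  tree-size : MinStrong D → SymmetricDigraph D → size D ≡ 2 * (n ∸ 1)
  tree-size min D-sym with ≤-trans 2≤k k≤n
  ... | s≤s _ = ≤-antisym (minStrong-size≤2[n-1] D min zero) (symmetric-size≥ D (proj₁ min) D-sym zero)

-- The case k = n

-- Reading a member as a digraph makes `deleteArc` and its lemmas applicable to it.
toDigraph : ∀ {n} {D : Digraph n} → Subgraph D → Digraph n
toDigraph H .N⁺ = A⁺ H
toDigraph {D = D} H .loopless x = loopless D x ∘ A⁺⊆N⁺ H x

F[n,n,ℓ]≤ : ∀ n ℓ → 2 ≤ n → ∀ m → F≡ n n ℓ m → m ≤ 2 * ℓ * (n ∸ 1)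
F[n,n,ℓ]≤ n@(suc _) ℓ 2≤n m ((D , ((p , ((S , ∣S∣≡n , fam , _) , _) , ℓ≤p) , critical) , refl) , _) =
  subst (size D ≤_) length-union (size≤length D union λ {x} {y} xy →
    decidable-stable ((x , y) ∈ᵃ? union) (necessary xy))
  where
  open InternallyDisjoint fam

  -- A set of n vertices is everything, so all members are spanning.
  spans : ∀ i x → x ∈ V (member i)
  spans i x = containsS i (subst (x ∈_) (sym (∣p∣≡n⇒p≡⊤ ∣S∣≡n)) ∈⊤)

  -- Only ℓ of the p members are kept, since the bound is in terms of ℓ.
  H : Fin ℓ → Subgraph D
  H i = member (inject≤ i ℓ≤p)

  inject-< : ∀ {i j} → i <ᶠ j → inject≤ i ℓ≤p <ᶠ inject≤ j ℓ≤p
  inject-< {i} {j} = subst₂ _<_ (sym (toℕ-inject≤ i ℓ≤p)) (sym (toℕ-inject≤ j ℓ≤p))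

  sparse : ∀ i → ∃[ L ] (Listed L ⇒ SubArc (H i)) × StronglyConnected (Listed L) × length L ≡ 2 * (n ∸ 1)
  sparse i = sparse-spanning-from-vertex (λ x y → y ∈? A⁺ (H i) x)
    (λ x y → strong (inject≤ i ℓ≤p) (spans _ x) (spans _ y)) zero

  L : Fin ℓ → List (Fin n × Fin n)
  L i = proj₁ (sparse i)

  union : List (Fin n × Fin n)
  union = concat (tabulate L)

  length-union : length union ≡ 2 * ℓ * (n ∸ 1)
  length-union = begin
    length union          ≡⟨ length-concat-tabulate L ⟩
    sum (length ∘ L)      ≡⟨ sum-const ℓ (length ∘ L) (λ i → proj₂ (proj₂ (proj₂ (sparse i)))) ⟩
    ℓ * (2 * (n ∸ 1))     ≡⟨ *-assoc ℓ 2 (n ∸ 1) ⟨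
    ℓ * 2 * (n ∸ 1)       ≡⟨ cong (_* (n ∸ 1)) (*-comm ℓ 2) ⟩
    2 * ℓ * (n ∸ 1) ∎
    where open ≡-Reasoning

  -- Deleting xy from each kept member leaves its sparse spanning list `L i` intact, so the member
  -- stays strong; arc-disjointness is inherited.
  survives : ∀ {x y} → (x , y) ∉ˡ union → ∀ S′ → ∣ S′ ∣ ≡ n → InternallyDisjoint (deleteArc D x y) S′ ℓ
  survives {x} {y} xy∉ S′ ∣S′∣≡n = record
    { member           = H′
    ; strong           = λ i {u} {v} _ _ → Star-map (kept i) (proj₁ (proj₂ (proj₂ (sparse i))) u v)
    ; containsS        = λ _ → ⊆⊤
    ; internallyVertex = λ _ → trans (∩-idem ⊤) (sym (∣p∣≡n⇒p≡⊤ ∣S′∣≡n))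
    ; arcDisjoint      = λ {i} {j} i<j ab∈i ab∈j → arcDisjoint (inject-< i<j)
                           (deleteArc⁻ (toDigraph (H i)) x y ab∈i) (deleteArc⁻ (toDigraph (H j)) x y ab∈j)
    }
    where
    H′ : Fin ℓ → Subgraph (deleteArc D x y)
    H′ i .V        = ⊤
    H′ i .A⁺       = N⁺ (deleteArc (toDigraph (H i)) x y)
    H′ i .A⁺⊆N⁺ u {v} uv = deleteArc⁺ D x y (A⁺⊆N⁺ (H i) u (deleteArc⁻ (toDigraph (H i)) x y uv))
      λ { refl → deleteArc-deleted (toDigraph (H i)) x y uv }
    H′ i .tail∈V _ = ∈⊤
    H′ i .head∈V _ = ∈⊤

    kept : ∀ i → Listed (L i) ⇒ SubArc (H′ i)
    kept i ab = deleteArc⁺ (toDigraph (H i)) x y (proj₁ (proj₂ (sparse i)) ab)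
      λ { refl → xy∉ (∈-concat⁺′ ab (∈-tabulate⁺ {f = L} i)) }

  necessary : ∀ {x y} → Arc D x y → ¬ (x , y) ∉ˡ union
  necessary xy xy∉ with critical xy
  -- At the set `S′` attaining the value m′ of D - xy, the surviving family forces ℓ ≤ m′.
  ... | m′ , ((S′ , ∣S′∣≡n , _ , maximal) , _) , m′<ℓ =
    <-irrefl refl (≤-trans m′<ℓ (maximal ℓ (survives xy∉ S′ ∣S′∣≡n)))

proposition3p9 : (∀ (n ℓ : ℕ) → 2 ≤ n → ∀ m → F≡ n n ℓ m → m ≤ 2 * ℓ * (n ∸ 1))
    × (∀ (n k : ℕ) → 2 ≤ k → k ≤ n →
    F≡ n k 1 (2 * (n ∸ 1))
    × (∀ (D : Digraph n) →
    Ex n k 1 D ⇔ (SymmetricDigraph D × IsTree (underlying D))))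
proposition3p9 = F[n,n,ℓ]≤ , λ n k 2≤k k≤n → F[n,k,1] n k 2≤k k≤n , Ex[n,k,1] n k 2≤k k≤n
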